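{- Let $x=(x_1,\dots,x_n)\in\mathbb{N}^n$, put $u_i=x_1+\cdots+x_i$ for $1\le i\le n$, and let $\tilde u=(u_n,u_{n-1},\dots,u_1)$, which is a partition. Then the number $N(\Pi_n(x))=\#(\Pi_n(x)\cap\mathbb{Z}^n)$ of integer points in $\Pi_n(x)$ is equal to the number of plane partitions of shape $\tilde u$ and largest part at most $2$.
   Context: $\mathbb N=\{0,1,2,\dots\}$. $\Pi_n(x)=\{y\in\mathbb{R}^n: y_i\ge 0,\ y_1+\cdots+y_i\le x_1+\cdots+x_i \text{ for all } 1\le i\le n\}$. For a partition $\lambda=(\lambda_1\ge\cdots\ge\lambda_\ell\ge 0)$, a plane partition of shape $\lambda$ and largest part at most $m$ is an array $(\pi_{ij})$ of integers with $1\le\pi_{ij}\le m$, defined for $1\le i\le\ell$, $1\le j\le\lambda_i$, which is weakly decreasing along rows and columns. -}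

module Defs where

open import Algebra.Bundles.Raw using (RawMonoid)
import Algebra.Definitions.RawMonoid as Sum
open import Data.Fin using (Fin; Fin′; zero; suc; toℕ; inject!; opposite) renaming (_≤_ to _≤ᶠ_)
open import Data.Fin.Properties using (opposite-prop)
open import Data.Integer as ℤ using (ℤ; +_; 0ℤ; 1ℤ)
open import Data.Nat as ℕ using (ℕ; z≤n; s≤s)
open import Data.Nat.Properties using (+-monoʳ-≤; ∸-monoʳ-≤)
open import Data.Product using (Σ; Σ-syntax; _,_; proj₁)
open import Data.Vec.Functional using (Vector; tail)
open import Function using (_∘_)
open import Function.Bundles using (Inverse)
open import Relation.Binary.Bundles using (Setoid)
import Relation.Binary.Construct.On as On
open import Relation.Binary.PropositionalEquality using (_≡_; _→-setoid_; setoid; subst₂; sym)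
open import Level using (0ℓ)

module _ {a ℓ} (M : RawMonoid a ℓ) where
  open RawMonoid M using (Carrier)

  -- With 0-based indices, entry i is x₀ + ⋯ + xᵢ, the last index included:
  -- Fin′ (suc i) has 1 + toℕ i elements.
  partialSums : ∀ {n} → Vector Carrier n → Vector Carrier n
  partialSums x i = Sum.sum M λ (j : Fin′ (suc i)) → x (inject! j)

-- Two integer arrays are the same when their entries agree; the proofs of
-- membership are ignored, so that each array is counted once.
Arrays : (I : Set) → ((I → ℤ) → Set) → Setoid 0ℓ 0ℓ
Arrays I P = On.setoid {B = Σ (I → ℤ) P} (I →-setoid ℤ) proj₁

HasCardinality : Setoid 0ℓ 0ℓ → ℕ → Set
HasCardinality S N = Inverse S (setoid (Fin N))

-- Membership of an integer vector in the polytope Πₙ(x); the defining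
-- inequalities between integers are the same as those between reals.
record _∈Π_ {n : ℕ} (y x : Vector ℤ n) : Set where
  field
    nonNegative : ∀ i → 0ℤ ℤ.≤ y i
    bounded     : ∀ i → partialSums ℤ.+-0-rawMonoid y i ℤ.≤ partialSums ℤ.+-0-rawMonoid x i

IntegerPoints-Π : ∀ {n} → Vector ℤ n → Setoid 0ℓ 0ℓ
IntegerPoints-Π {n} x = Arrays (Fin n) (_∈Π x)

-- Zero parts are allowed.
record Partition (ℓ : ℕ) : Set where
  field
    part       : Vector ℕ ℓ
    decreasing : ∀ {i j} → i ≤ᶠ j → part j ℕ.≤ part i

open Partition public

Cell : ∀ {ℓ} → Partition ℓ → Set
Cell {ℓ} λs = Σ[ i ∈ Fin ℓ ] Fin (part λs i)

record IsPlanePartition {ℓ : ℕ} (λs : Partition ℓ) (m : ℕ) (π : Cell λs → ℤ) : Set where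
  field
    positive : ∀ c → 1ℤ ℤ.≤ π c
    atMost   : ∀ c → π c ℤ.≤ + m
    rows     : ∀ {i} {j j′ : Fin (part λs i)} → j ≤ᶠ j′ → π (i , j′) ℤ.≤ π (i , j)
    columns  : ∀ {i i′} {j : Fin (part λs i)} {j′ : Fin (part λs i′)} →
               i ≤ᶠ i′ → toℕ j ≡ toℕ j′ → π (i′ , j′) ℤ.≤ π (i , j)

PlanePartitions : ∀ {ℓ} → Partition ℓ → ℕ → Setoid 0ℓ 0ℓ
PlanePartitions λs m = Arrays (Cell λs) (IsPlanePartition λs m)

partialSums-mono : ∀ {n} (x : Vector ℕ n) {i j} → i ≤ᶠ j →
                   partialSums ℕ.+-0-rawMonoid x i ℕ.≤ partialSums ℕ.+-0-rawMonoid x j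
partialSums-mono x {zero}  {j}     _         = +-monoʳ-≤ (x zero) z≤n
partialSums-mono x {suc i} {suc j} (s≤s i≤j) = +-monoʳ-≤ (x zero) (partialSums-mono (tail x) i≤j)

opposite-antitone : ∀ {n} {i j : Fin n} → i ≤ᶠ j → opposite j ≤ᶠ opposite i
opposite-antitone {n} {i} {j} i≤j =
  subst₂ ℕ._≤_ (sym (opposite-prop j)) (sym (opposite-prop i)) (∸-monoʳ-≤ n (s≤s i≤j))

reversedPartialSums : ∀ {n} → Vector ℕ n → Partition n
reversedPartialSums x = record
  { part       = partialSums ℕ.+-0-rawMonoid x ∘ opposite
  ; decreasing = partialSums-mono x ∘ opposite-antitone
  }

{-# OPTIONS --safe #-}
-- Both sides are in bijection with the partitions μ contained in
-- ũ = (uₙ, …, u₁). An integer point y corresponds to its reversed sequence of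
-- partial sums, from which y is recovered by taking differences. A plane
-- partition with entries in {1, 2} corresponds to the shape formed by its 2's:
-- the 2's are left-justified in each row, and their numbers weakly decrease
-- from row to row.
module Submission where

open import Defs
open import Data.Bool using (if_then_else_)
open import Data.Fin using (Fin; zero; suc; toℕ; fromℕ<; inject₁; combine; opposite; finToFun; funToFin) renaming (_≤_ to _≤ᶠ_)
open import Data.Fin.Induction using (<-weakInduction)
open import Data.Fin.Properties as Finₚ using (all?; toℕ-fromℕ<; fromℕ<-cong; fromℕ<-toℕ; finToFun-funToFin; funToFin-finToFin; opposite-involutive)
open import Data.Integer as ℤ using (ℤ; +_; 0ℤ; 1ℤ; ∣_∣; +≤+)
import Data.Integer.Properties as ℤₚ
open import Data.List using (List; length; lookup; filter; allFin)
open import Data.List.Membership.Propositional.Properties using (∈-lookup; ∈-filter⁺; ∈-filter⁻; ∈-allFin)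
import Data.List.Relation.Unary.All as All
open import Data.List.Relation.Unary.AllPairs using (_∷_)
open import Data.List.Relation.Unary.Any using (index)
open import Data.List.Relation.Unary.Any.Properties using (lookup-index)
open import Data.List.Relation.Unary.Unique.Propositional using (Unique)
import Data.List.Relation.Unary.Unique.Propositional.Properties as Uniqueₚ
open import Data.Nat as ℕ using (ℕ; zero; suc; z≤n; s≤s; _+_; _∸_; _≤_; _<_; _≤?_; _^_)
open import Data.Nat.Properties using (+-identityʳ; +-assoc; m+n∸m≡n; m+[n∸m]≡n; n≤1+n; ≤-reflexive; ≤-trans; <-≤-trans)
open import Data.Product using (Σ; Σ-syntax; ∃-syntax; _×_; _,_; proj₁; proj₂)
open import Data.Vec.Functional using (Vector; map; tail)
open import Function using (_∘_)
open import Function.Bundles using (Inverse)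
import Function.Construct.Composition as Composition
open import Level using (0ℓ)
open import Relation.Binary.Bundles using (Setoid)
import Relation.Binary.Construct.On as On
open import Relation.Binary.PropositionalEquality
open import Relation.Nullary using (does; yes; no; contradiction)
open import Relation.Nullary.Decidable using (_×-dec_; _→-dec_)
open import Relation.Unary using (Pred; Decidable)

-- Setoid bijections and the counting of decidable subsets of `Fin k`.

mkInverse : (S T : Setoid 0ℓ 0ℓ) → let open Setoid in
            (to : Carrier S → Carrier T) (from : Carrier T → Carrier S) →
            (∀ {a b} → _≈_ S a b → _≈_ T (to a) (to b)) →
            (∀ {a b} → _≈_ T a b → _≈_ S (from a) (from b)) →
            (∀ b → _≈_ T (to (from b)) b) →
            (∀ a → _≈_ S (from (to a)) a) →
            Inverse S T
mkInverse S T to from to-cong from-cong to∘from from∘to = record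
  { to        = to
  ; from      = from
  ; to-cong   = to-cong
  ; from-cong = from-cong
  ; inverse   = (λ e → Setoid.trans T (to-cong e) (to∘from _))
              , (λ e → Setoid.trans S (from-cong e) (from∘to _))
  }

lookup-injective : ∀ {A : Set} {xs : List A} → Unique xs →
                   ∀ i j → lookup xs i ≡ lookup xs j → i ≡ j
lookup-injective (_ ∷ _)    zero    zero    _ = refl
lookup-injective (x∉ ∷ _)   zero    (suc j) e = contradiction e (All.lookup x∉ (∈-lookup j))
lookup-injective (x∉ ∷ _)   (suc i) zero    e = contradiction (sym e) (All.lookup x∉ (∈-lookup i))
lookup-injective (_ ∷ uniq) (suc i) (suc j) e = cong suc (lookup-injective uniq i j e)

Subset : ∀ {k} → Pred (Fin k) 0ℓ → Setoid 0ℓ 0ℓ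
Subset {k} P = On.setoid {B = Σ (Fin k) P} (setoid (Fin k)) proj₁

-- Filtering `allFin k` lists each element once, so an element is numbered by its position in the
-- list, whichever proof of `P` accompanies it.
subset-finite : ∀ {k} {P : Pred (Fin k) 0ℓ} → Decidable P → ∃[ N ] HasCardinality (Subset P) N
subset-finite {k} {P} P? = length elements , mkInverse (Subset P) (setoid _) to from
  (λ {a} {b} e → injective (trans (lookup-to a) (trans e (sym (lookup-to b)))))
  (cong (lookup elements))
  (λ i → injective (lookup-to (from i)))
  lookup-to
  where
  elements : List (Fin k)
  elements = filter P? (allFin k)

  injective : ∀ {i j} → lookup elements i ≡ lookup elements j → i ≡ j
  injective = lookup-injective (Uniqueₚ.filter⁺ P? (Uniqueₚ.allFin⁺ k)) _ _

  to : Σ (Fin k) P → Fin (length elements)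
  to (i , p) = index (∈-filter⁺ P? (∈-allFin i) p)

  from : Fin (length elements) → Σ (Fin k) P
  from i = lookup elements i , proj₂ (∈-filter⁻ P? {xs = allFin k} (∈-lookup i))

  lookup-to : ∀ a → lookup elements (to a) ≡ proj₁ a
  lookup-to (i , p) = sym (lookup-index (∈-filter⁺ P? (∈-allFin i) p))

-- Finiteness of the set of partitions contained in a given one.

funToFin-cong : ∀ {m n} {f g : Fin m → Fin n} → f ≗ g → funToFin f ≡ funToFin g
funToFin-cong {zero}  e = refl
funToFin-cong {suc m} e = cong₂ combine (e zero) (funToFin-cong (e ∘ suc))

Subpartitions : ∀ {ℓ} → Partition ℓ → Setoid 0ℓ 0ℓ
Subpartitions {ℓ} λs =
  On.setoid {B = Σ[ μ ∈ Partition ℓ ] (∀ i → part μ i ≤ part λs i)} (Fin ℓ →-setoid ℕ) (part ∘ proj₁)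

-- A single bound for all rows, so that sequences of parts can be coded as functions into one `Fin`.
parts-bounded : ∀ {ℓ} (λs : Partition ℓ) → ∃[ b ] ∀ i → part λs i ≤ b
parts-bounded {zero}  λs = 0 , λ ()
parts-bounded {suc ℓ} λs = part λs zero , λ i → decreasing λs z≤n

-- A sequence of ℓ parts, each at most `b`, is the string of base-(b+1) digits of one number below
-- `suc b ^ ℓ`. Being a partition inside `λs` is decidable on these codes.
subpartitions-finite : ∀ {ℓ} (λs : Partition ℓ) → ∃[ N ] HasCardinality (Subpartitions λs) N
subpartitions-finite {ℓ} λs =
  let N , card = subset-finite Code? in N , Composition.inverse encoding card
  where
  b = proj₁ (parts-bounded λs)

  decode : Fin (suc b ^ ℓ) → Vector ℕ ℓ
  decode k = toℕ ∘ finToFun k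

  Code : Pred (Fin (suc b ^ ℓ)) 0ℓ
  Code k = (∀ i j → i ≤ᶠ j → decode k j ≤ decode k i) × (∀ i → decode k i ≤ part λs i)

  Code? : Decidable Code
  Code? k = all? (λ i → all? λ j → (i Finₚ.≤? j) →-dec (decode k j ≤? decode k i))
      ×-dec all? (λ i → decode k i ≤? part λs i)

  Carrier = Setoid.Carrier (Subpartitions λs)

  bounded : (μ : Carrier) → ∀ i → part (proj₁ μ) i < suc b
  bounded (μ , μ≤λ) i = s≤s (≤-trans (μ≤λ i) (proj₂ (parts-bounded λs) i))

  encode : Carrier → Fin (suc b ^ ℓ)
  encode μ = funToFin λ i → fromℕ< (bounded μ i)

  decode-encode : ∀ μ → decode (encode μ) ≗ part (proj₁ μ)
  decode-encode μ i =
    trans (cong toℕ (finToFun-funToFin (λ i → fromℕ< (bounded μ i)) i)) (toℕ-fromℕ< (bounded μ i))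

  from : Σ _ Code → Carrier
  from (k , dec , k≤λ) = record { part = decode k ; decreasing = dec _ _ } , k≤λ

  encoding : Inverse (Subpartitions λs) (Subset Code)
  encoding = mkInverse (Subpartitions λs) (Subset Code)
    (λ μ → encode μ
         , (λ i j i≤j → subst₂ _≤_ (sym (decode-encode μ j)) (sym (decode-encode μ i)) (decreasing (proj₁ μ) i≤j))
         , (λ i → subst (_≤ part λs i) (sym (decode-encode μ i)) (proj₂ μ i)))
    from
    (λ {μ} {ν} e → funToFin-cong λ i → fromℕ<-cong _ _ (e i) (bounded μ i) (bounded ν i))
    (λ e i → cong (λ k → decode k i) e)
    (λ (k , c) → trans (funToFin-cong λ i → fromℕ<-toℕ (finToFun k i) (bounded (from (k , c)) i))
                       (funToFin-finToFin {ℓ} {suc b} k))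
    decode-encode

-- Integer points and their partial sums.

private
  ∑ : ∀ {n} → Vector ℕ n → Vector ℕ n
  ∑ = partialSums ℕ.+-0-rawMonoid

-- Inverse to `∑` on weakly increasing vectors, where truncated subtraction is exact.
differences : ∀ {n} → Vector ℕ n → Vector ℕ n
differences t zero    = t zero
differences t (suc i) = t (suc i) ∸ t (inject₁ i)

differences-cong : ∀ {n} {s t : Vector ℕ n} → s ≗ t → differences s ≗ differences t
differences-cong e zero    = e zero
differences-cong e (suc i) = cong₂ _∸_ (e (suc i)) (e (inject₁ i))

-- Partial sums unfold at the first term; taking differences requires splitting off the last term
-- instead.
partialSums-suc : ∀ {n} (x : Vector ℕ (suc n)) i → ∑ x (suc i) ≡ ∑ x (inject₁ i) + x (suc i)
partialSums-suc x zero    = cong₂ _+_ (sym (+-identityʳ (x zero))) (+-identityʳ (x (suc zero)))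
partialSums-suc x (suc i) =
  trans (cong (_+_ (x zero)) (partialSums-suc (tail x) i)) (sym (+-assoc (x zero) _ _))

differences-partialSums : ∀ {n} (x : Vector ℕ n) → differences (∑ x) ≗ x
differences-partialSums x zero    = +-identityʳ (x zero)
differences-partialSums x (suc i) =
  trans (cong (_∸ ∑ x (inject₁ i)) (partialSums-suc x i)) (m+n∸m≡n (∑ x (inject₁ i)) _)

partialSums-differences : ∀ {n} (t : Vector ℕ n) → (∀ {i j} → i ≤ᶠ j → t i ≤ t j) →
                          ∑ (differences t) ≗ t
partialSums-differences {suc n} t mono = <-weakInduction _ (+-identityʳ (t zero)) λ i ih → begin
  ∑ (differences t) (suc i)                             ≡⟨ partialSums-suc (differences t) i ⟩
  ∑ (differences t) (inject₁ i) + differences t (suc i) ≡⟨ cong (_+ differences t (suc i)) ih ⟩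
  t (inject₁ i) + (t (suc i) ∸ t (inject₁ i))           ≡⟨ m+[n∸m]≡n (mono (inject₁≤suc i)) ⟩
  t (suc i)                                             ∎
  where
  open ≡-Reasoning
  inject₁≤suc : ∀ {n} (i : Fin n) → inject₁ i ≤ᶠ suc i
  inject₁≤suc i = ≤-trans (≤-reflexive (Finₚ.toℕ-inject₁ i)) (n≤1+n _)

-- Moves the inequalities of the polytope between ℤ and ℕ. Entrywise agreement suffices for `y`,
-- since an integer point is known only entrywise to equal its absolute values.
partialSums-+ : ∀ {n} {y : Vector ℤ n} (z : Vector ℕ n) → y ≗ map +_ z →
                partialSums ℤ.+-0-rawMonoid y ≗ map +_ (∑ z)
partialSums-+ z e zero    = cong (ℤ._+ 0ℤ) (e zero)
partialSums-+ z e (suc i) = cong₂ ℤ._+_ (e zero) (partialSums-+ (tail z) (e ∘ suc) i)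

partialSums-cong : ∀ {n} {y z : Vector ℕ n} → y ≗ z → ∑ y ≗ ∑ z
partialSums-cong {y = y} {z} e i =
  -- The integer vector `map +_ y` agrees entrywise with the images of both `y` and `z`.
  ℤₚ.+-injective (trans (sym (partialSums-+ y (λ _ → refl) i)) (partialSums-+ z (cong +_ ∘ e) i))

-- Nonnegativity of `y` makes its partial sums weakly increasing, so their reversal is a partition;
-- the remaining inequalities of the polytope say that it is contained in ũ.
integerPoints↔subpartitions : ∀ {n} (x : Vector ℕ n) →
  Inverse (IntegerPoints-Π (map +_ x)) (Subpartitions (reversedPartialSums x))
integerPoints↔subpartitions {n} x = mkInverse _ (Subpartitions (reversedPartialSums x)) to from
  (λ {(y , _)} {(z , _)} e i → partialSums-cong {y = ∣_∣ ∘ y} {∣_∣ ∘ z} (cong ∣_∣ ∘ e) (opposite i))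
  (λ e i → cong +_ (differences-cong (e ∘ opposite) i))
  (λ μ i → trans (partialSums-point μ (opposite i)) (cong (part (proj₁ μ)) (opposite-involutive i)))
  from∘to
  where
  Carrier = Setoid.Carrier (Subpartitions (reversedPartialSums x))

  +∣y∣ : ∀ {y} → y ∈Π map +_ x → y ≗ map +_ (∣_∣ ∘ y)
  +∣y∣ p i = sym (ℤₚ.0≤i⇒+∣i∣≡i (_∈Π_.nonNegative p i))

  to : Σ (Vector ℤ n) (_∈Π map +_ x) → Carrier
  to (y , p) = reversedPartialSums (∣_∣ ∘ y) , λ i → ℤₚ.drop‿+≤+
    (subst₂ ℤ._≤_ (partialSums-+ (∣_∣ ∘ y) (+∣y∣ p) (opposite i)) (partialSums-+ x (λ _ → refl) (opposite i))
      (_∈Π_.bounded p (opposite i)))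

  point : Carrier → Vector ℕ n
  point (μ , _) = differences (part μ ∘ opposite)

  partialSums-point : ∀ μ → ∑ (point μ) ≗ part (proj₁ μ) ∘ opposite
  partialSums-point (μ , _) = partialSums-differences _ (decreasing μ ∘ opposite-antitone)

  from : Carrier → Σ (Vector ℤ n) (_∈Π map +_ x)
  from μ = map +_ (point μ) , record
    { nonNegative = λ i → +≤+ z≤n
    ; bounded     = λ i → subst₂ ℤ._≤_ (sym (partialSums-+ (point μ) (λ _ → refl) i)) (sym (partialSums-+ x (λ _ → refl) i))
        -- Containment in row `opposite i` bounds partial sum `i`, because reversing twice is the
        -- identity.
        (+≤+ (subst₂ _≤_ (sym (partialSums-point μ i)) (cong (∑ x) (opposite-involutive i)) (proj₂ μ (opposite i))))
    }

  from∘to : ∀ a → proj₁ (from (to a)) ≗ proj₁ a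
  from∘to (y , p) i = trans
    (cong +_ (trans (differences-cong (cong (∑ (∣_∣ ∘ y)) ∘ opposite-involutive) i)
                    (differences-partialSums (∣_∣ ∘ y) i)))
    (sym (+∣y∣ p i))

-- Rows of ones and twos, and plane partitions with parts at most 2.

-- Entry j of a row that begins with t twos, followed by ones.
level : ℕ → ℕ → ℤ
level zero    j       = 1ℤ
level (suc t) zero    = + 2
level (suc t) (suc j) = level t j

1≤level : ∀ t j → 1ℤ ℤ.≤ level t j
1≤level zero    j       = ℤₚ.≤-refl
1≤level (suc t) zero    = +≤+ (s≤s z≤n)
1≤level (suc t) (suc j) = 1≤level t j

level≤2 : ∀ t j → level t j ℤ.≤ + 2
level≤2 zero    j       = +≤+ (s≤s z≤n)
level≤2 (suc t) zero    = ℤₚ.≤-refl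
level≤2 (suc t) (suc j) = level≤2 t j

-- Either the left side is 1, or the right side is 2, or both rows lose their first entry. This
-- gives the row and the column condition at once.
level-mono : ∀ {s t i j} → s ≤ t → i ≤ j → level s j ℤ.≤ level t i
level-mono {t = t} {i = i}                         z≤n       _         = 1≤level t i
level-mono {s = suc s} {i = zero}  {j = j}         (s≤s _)   _         = level≤2 (suc s) j
level-mono                                         (s≤s s≤t) (s≤s i≤j) = level-mono s≤t i≤j

-- If `s` exceeded `t`, column `t` would give 2 ≤ 1. Only columns below `s` are tested, as these are
-- the ones known to lie inside the shape.
level-cancel-≤ : ∀ {s t} → (∀ {j} → j < s → level s j ℤ.≤ level t j) → s ≤ t
level-cancel-≤ {zero}          _ = z≤n
level-cancel-≤ {suc s} {zero}  h with h (s≤s z≤n)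
... | +≤+ (s≤s ())
level-cancel-≤ {suc s} {suc t} h = s≤s (level-cancel-≤ (h ∘ s≤s))

-- Counting only the initial run mirrors the recursion of `level`; in a weakly decreasing row with
-- entries at most 2 it counts all twos.
leadingTwos : ∀ {k} → Vector ℤ k → ℕ
leadingTwos {zero}  r = 0
leadingTwos {suc k} r = if does (r zero ℤ.≟ + 2) then suc (leadingTwos (tail r)) else 0

leadingTwos-cong : ∀ {k} {r r′ : Vector ℤ k} → r ≗ r′ → leadingTwos r ≡ leadingTwos r′
leadingTwos-cong {zero}  e = refl
leadingTwos-cong {suc k} e =
  cong₂ (λ z t → if does (z ℤ.≟ + 2) then suc t else 0) (e zero) (leadingTwos-cong (e ∘ suc))

leadingTwos≤length : ∀ {k} (r : Vector ℤ k) → leadingTwos r ≤ k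
leadingTwos≤length {zero}  r = z≤n
leadingTwos≤length {suc k} r with r zero ℤ.≟ + 2
... | yes _ = s≤s (leadingTwos≤length (tail r))
... | no  _ = z≤n

leadingTwos-level : ∀ {k t} → t ≤ k → leadingTwos {k} (level t ∘ toℕ) ≡ t
leadingTwos-level {zero}  z≤n       = refl
leadingTwos-level {suc k} z≤n       = refl
leadingTwos-level {suc k} (s≤s t≤k) = cong suc (leadingTwos-level t≤k)

≤2∧≢2⇒≤1 : ∀ {z} → z ℤ.≤ + 2 → z ≢ + 2 → z ℤ.≤ 1ℤ
≤2∧≢2⇒≤1 z≤2 z≢2 = ℤₚ.i<j⇒i≤pred[j] (ℤₚ.≤∧≢⇒< z≤2 z≢2)

-- Once an entry differs from 2 it is at most 1, and so are all later ones; being positive, they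
-- equal 1.
level-leadingTwos : ∀ {k} (r : Vector ℤ k) → (∀ j → 1ℤ ℤ.≤ r j) → (∀ j → r j ℤ.≤ + 2) →
                    (∀ {j j′} → j ≤ᶠ j′ → r j′ ℤ.≤ r j) → level (leadingTwos r) ∘ toℕ ≗ r
level-leadingTwos {suc k} r 1≤r r≤2 decr j with r zero ℤ.≟ + 2
level-leadingTwos {suc k} r 1≤r r≤2 decr j       | no r₀≢2 =
  ℤₚ.≤-antisym (1≤r j) (ℤₚ.≤-trans (decr z≤n) (≤2∧≢2⇒≤1 (r≤2 zero) r₀≢2))
level-leadingTwos {suc k} r 1≤r r≤2 decr zero    | yes r₀≡2 = sym r₀≡2
level-leadingTwos {suc k} r 1≤r r≤2 decr (suc j) | yes _ =
  level-leadingTwos (tail r) (1≤r ∘ suc) (r≤2 ∘ suc) (decr ∘ s≤s) j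

planePartitions↔subpartitions : ∀ {ℓ} (λs : Partition ℓ) →
  Inverse (PlanePartitions λs 2) (Subpartitions λs)
planePartitions↔subpartitions {ℓ} λs = mkInverse _ (Subpartitions λs) to from
  (λ e i → leadingTwos-cong (e ∘ (i ,_)))
  (λ e (i , j) → cong (λ t → level t (toℕ j)) (e i))
  (λ (μ , μ≤λ) i → leadingTwos-level (μ≤λ i))
  (λ (π , p) (i , j) → level-row p i j)
  where
  open IsPlanePartition

  row : (Cell λs → ℤ) → ∀ i → Vector ℤ (part λs i)
  row π i j = π (i , j)

  level-row : ∀ {π} → IsPlanePartition λs 2 π → ∀ i → level (leadingTwos (row π i)) ∘ toℕ ≗ row π i
  level-row {π} p i = level-leadingTwos (row π i) (positive p ∘ (i ,_)) (atMost p ∘ (i ,_)) (rows p)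

  twos-decreasing : ∀ {π} → IsPlanePartition λs 2 π →
                    ∀ {i i′} → i ≤ᶠ i′ → leadingTwos (row π i′) ≤ leadingTwos (row π i)
  twos-decreasing {π} p {i} {i′} i≤i′ = level-cancel-≤ λ {j} j<twos →
    -- A column holding a leading 2 in row `i′` lies in that row, hence also in the row `i` above
    -- it, which is at least as long; so the column condition applies there.
    let j<λi′ = <-≤-trans j<twos (leadingTwos≤length (row π i′))
        j<λi  = <-≤-trans j<λi′ (decreasing λs i≤i′)
    in subst₂ ℤ._≤_ (entry j<λi′) (entry j<λi)
         (columns p i≤i′ (trans (toℕ-fromℕ< j<λi) (sym (toℕ-fromℕ< j<λi′))))
    where
    entry : ∀ {i j} (j<λi : j < part λs i) → π (i , fromℕ< j<λi) ≡ level (leadingTwos (row π i)) j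
    entry {i} j<λi =
      trans (sym (level-row p i (fromℕ< j<λi))) (cong (level (leadingTwos (row π i))) (toℕ-fromℕ< j<λi))

  to : Σ (Cell λs → ℤ) (IsPlanePartition λs 2) → Setoid.Carrier (Subpartitions λs)
  to (π , p) = record { part = leadingTwos ∘ row π ; decreasing = twos-decreasing p }
             , leadingTwos≤length ∘ row π

  from : Setoid.Carrier (Subpartitions λs) → Σ (Cell λs → ℤ) (IsPlanePartition λs 2)
  from (μ , _) = (λ (i , j) → level (part μ i) (toℕ j)) , record
    { positive = λ (i , j) → 1≤level (part μ i) (toℕ j)
    ; atMost   = λ (i , j) → level≤2 (part μ i) (toℕ j)
    ; rows     = λ {i} → level-mono (≤-reflexive {part μ i} refl)
    ; columns  = λ i≤i′ j≡j′ → level-mono (decreasing μ i≤i′) (≤-reflexive j≡j′)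
    }

theorem12 : ∀ {n} (x : Vector ℕ n) →
    ∃[ N ] HasCardinality (IntegerPoints-Π (map +_ x)) N
    × HasCardinality (PlanePartitions (reversedPartialSums x) 2) N
theorem12 x =
  -- The common count is the number of partitions contained in ũ.
  let N , card = subpartitions-finite (reversedPartialSums x)
  in N , Composition.inverse (integerPoints↔subpartitions x) card
       , Composition.inverse (planePartitions↔subpartitions (reversedPartialSums x)) card
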